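{- There is an absolute constant $c>0$ such that for every Boolean function $f$ and every Boolean formula $F$ over $\{\land_2,\lor_2,\lnot\}$ computing $f$, $\mathsf{EC^F}(F)\ge c\left(\sqrt{L(F)}-\mathrm{depth}(F)\right)$; that is, $\mathsf{EC^F}(F)=\Omega\left(\sqrt{L(F)}-\mathrm{depth}(F)\right)$.
   Context: A Boolean formula $F$ over $\{\land_2,\lor_2,\lnot\}$ (AND and OR of fan-in 2, and NOT) is a Boolean circuit whose underlying graph is a tree: leaves are labeled by variables $x_1,\dots,x_n$ (a variable may label several leaves), internal nodes (including the root) are labeled by functions in the basis. $L(F)$ is the number of leaves of $F$ and $\mathrm{depth}(F)$ is the length of the longest path from the root to any leaf. $\mathsf{EC^F}(F)$ is the maximum over all inputs $a\in\{0,1\}^n$ of the number of non-input gates (internal nodes) of $F$ that output $1$ on $a$. -}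

module Defs where

open import Data.Bool.Base using (Bool; true; false; _∧_; _∨_; if_then_else_)
import Data.Bool.Base as Bool
open import Data.Fin.Base using (Fin)
open import Data.Integer.Base using (+_)
open import Data.List.Base using (List; []; _∷_; map; cartesianProductWith)
open import Data.List.Extrema.Nat using (max)
open import Data.List.Membership.Propositional using (_∈_)
open import Data.List.Membership.Propositional.Properties using (∈-cartesianProductWith⁺)
open import Data.List.Relation.Unary.Any using (here; there)
open import Data.Nat.Base using (ℕ; suc; _+_; _⊔_)
open import Data.Rational.Base using (ℚ; 0ℚ; _/_; _*_; _≤_)
open import Data.Sum.Base using (_⊎_)
open import Data.Vec.Base using (Vec; lookup) renaming ([] to []ᵥ; _∷_ to _∷ᵥ_)
open import Relation.Binary.PropositionalEquality using (_≡_; refl)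

Input : ℕ → Set
Input n = Vec Bool n

data Tree (n : ℕ) : Set where
  var     : Fin n → Tree n
  not     : Tree n → Tree n
  and or  : Tree n → Tree n → Tree n

data IsGate {n : ℕ} : Tree n → Set where
  not : ∀ {t}   → IsGate (not t)
  and : ∀ {s t} → IsGate (and s t)
  or  : ∀ {s t} → IsGate (or s t)

-- The root of a formula is an internal node, so a lone variable is not a
-- formula.  (It would have √ L - depth = 1 but no gate that could fire.)
record Formula (n : ℕ) : Set where
  constructor formula
  field
    tree   : Tree n
    isGate : IsGate tree

open Formula public

evalTree : ∀ {n} → Tree n → Input n → Bool
evalTree (var i)   a = lookup a i
evalTree (not t)   a = Bool.not (evalTree t a)
evalTree (and s t) a = evalTree s a ∧ evalTree t a
evalTree (or s t)  a = evalTree s a ∨ evalTree t a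

leavesTree : ∀ {n} → Tree n → ℕ
leavesTree (var i)   = 1
leavesTree (not t)   = leavesTree t
leavesTree (and s t) = leavesTree s + leavesTree t
leavesTree (or s t)  = leavesTree s + leavesTree t

-- Path length is counted in edges; NOT gates contribute.
depthTree : ∀ {n} → Tree n → ℕ
depthTree (var i)   = 0
depthTree (not t)   = suc (depthTree t)
depthTree (and s t) = suc (depthTree s ⊔ depthTree t)
depthTree (or s t)  = suc (depthTree s ⊔ depthTree t)

bit : Bool → ℕ
bit b = if b then 1 else 0

activeGates : ∀ {n} → Tree n → Input n → ℕ
activeGates (var i)       a = 0
activeGates g@(not t)     a = bit (evalTree g a) + activeGates t a
activeGates g@(and s t)   a = bit (evalTree g a) + (activeGates s a + activeGates t a)
activeGates g@(or s t)    a = bit (evalTree g a) + (activeGates s a + activeGates t a)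

bools : List Bool
bools = true ∷ false ∷ []

inputs : ∀ n → List (Input n)
inputs 0       = []ᵥ ∷ []
inputs (suc n) = cartesianProductWith _∷ᵥ_ bools (inputs n)

inputs-complete : ∀ {n} (a : Input n) → a ∈ inputs n
inputs-complete []ᵥ          = here refl
inputs-complete (true ∷ᵥ a)  = ∈-cartesianProductWith⁺ _∷ᵥ_ {xs = bools} (here refl) (inputs-complete a)
inputs-complete (false ∷ᵥ a) = ∈-cartesianProductWith⁺ _∷ᵥ_ {xs = bools} (there (here refl)) (inputs-complete a)

_Computes_ : ∀ {n} → Formula n → (Input n → Bool) → Set
F Computes f = ∀ a → evalTree (tree F) a ≡ f a

L : ∀ {n} → Formula n → ℕ
L F = leavesTree (tree F)

depth : ∀ {n} → Formula n → ℕ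
depth F = depthTree (tree F)

ECᶠ : ∀ {n} → Formula n → ℕ
ECᶠ {n} F = max 0 (map (activeGates (tree F)) (inputs n))

fromℕ : ℕ → ℚ
fromℕ m = + m / 1

-- The rational lower Dedekind cut of the real number √ m.  As √ m is the
-- supremum of this set, for rational c > 0, d, e the real inequality
-- c (√ m - d) ≤ e says exactly that c (r - d) ≤ e for every r in the cut.
_≤√_ : ℚ → ℕ → Set
r ≤√ m = r ≤ 0ℚ ⊎ r * r ≤ fromℕ m

{-# OPTIONS --safe #-}

-- Let N be the number of NOT gates, d the depth and E the energy complexity.
-- On the all-zeros input every NOT gate applied to a variable fires, and for
-- every other NOT gate either it or the gate below it fires; a firing gate
-- serves at most two NOT gates in this way, hence N ≤ 2 E.
-- On the all-ones input every AND and OR gate without a NOT gate below it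
-- fires, and each NOT gate spoils at most d of the L - 1 binary gates; hence
-- L ≤ 1 + E + N d.  Since d ≥ 1, the two bounds give L ≤ (d + 2 E)².

module Submission where

open import Defs
open import Algebra.Properties.AbelianGroup using (xyx⁻¹≈y)
open import Data.Bool.Base using (Bool; true; false; _∧_; _∨_)
import Data.Bool.Base as Bool
open import Data.Integer.Base using (+_)
import Data.Integer.Base as ℤ
import Data.Integer.Properties as ℤ
open import Data.List.Extrema.Nat using (v≤max⁺)
open import Data.List.Membership.Propositional using (lose)
open import Data.List.Membership.Propositional.Properties using (∈-map⁺)
open import Data.Nat.Base using (ℕ; suc; z≤n; s≤s)
import Data.Nat.Base as ℕ
import Data.Nat.Coprimality as Coprime
import Data.Nat.Properties as ℕ
open import Data.Nat.Tactic.RingSolver using (solve-∀)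
open import Data.Product.Base using (∃-syntax; _×_; _,_)
open import Data.Rational.Base
  using (ℚ; mkℚ; 0ℚ; ½; _<_; _≤_; _+_; _*_; _-_; -_; _/_; *≤*; *<*; nonNegative; positive)
import Data.Rational.Properties as ℚ
open import Data.Sum.Base using (inj₁; inj₂)
open import Data.Vec.Base using (replicate)
open import Data.Vec.Properties using (lookup-replicate)
open import Relation.Binary.PropositionalEquality
  using (_≡_; refl; sym; cong; cong₂; subst)
open import Relation.Nullary using (yes; no; contradiction)

private
  variable
    n : ℕ

-- The all-zeros input: NOT gates against firing gates.

nots : Tree n → ℕ
nots (var i)   = 0
nots (not t)   = suc (nots t)
nots (and s t) = nots s ℕ.+ nots t
nots (or s t)  = nots s ℕ.+ nots t

zeros ones : Input n
zeros = replicate _ false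
ones  = replicate _ true

nots-step : ∀ b {ms mt bs bt as at} →
            ms ℕ.+ bs ℕ.≤ 2 ℕ.* as → mt ℕ.+ bt ℕ.≤ 2 ℕ.* at →
            ms ℕ.+ mt ℕ.+ b ℕ.≤ 2 ℕ.* (b ℕ.+ (as ℕ.+ at))
nots-step b {ms} {mt} {bs} {bt} {as} {at} hs ht = begin
  ms ℕ.+ mt ℕ.+ b
    ≤⟨ ℕ.+-mono-≤ (ℕ.+-mono-≤ (ℕ.m+n≤o⇒m≤o ms hs) (ℕ.m+n≤o⇒m≤o mt ht)) (ℕ.m≤n*m b 2) ⟩
  2 ℕ.* as ℕ.+ 2 ℕ.* at ℕ.+ 2 ℕ.* b
    ≡⟨ rearrange as at b ⟩
  2 ℕ.* (b ℕ.+ (as ℕ.+ at)) ∎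
  where
  open ℕ.≤-Reasoning
  rearrange : ∀ x y z → 2 ℕ.* x ℕ.+ 2 ℕ.* y ℕ.+ 2 ℕ.* z ≡ 2 ℕ.* (z ℕ.+ (x ℕ.+ y))
  rearrange = solve-∀

-- Counting the root's value on the left is what makes the induction pass a NOT
-- gate: exactly one of the gate and its child outputs 1.
nots-zeros : (t : Tree n) →
             nots t ℕ.+ bit (evalTree t zeros) ℕ.≤ 2 ℕ.* activeGates t zeros
-- A leaf outputs 0 here; an output of 1 would have no gate to pay for it.
nots-zeros (var i) rewrite lookup-replicate i false = z≤n
nots-zeros (not t) with evalTree t zeros | nots-zeros t
... | true  | ih = subst (ℕ._≤ 2 ℕ.* activeGates t zeros) (ℕ.+-suc (nots t) 0) ih
... | false | ih = begin
  suc (nots t) ℕ.+ 1                ≡⟨ ℕ.+-suc (suc (nots t)) 0 ⟩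
  2 ℕ.+ (nots t ℕ.+ 0)              ≤⟨ ℕ.+-monoʳ-≤ 2 ih ⟩
  2 ℕ.+ 2 ℕ.* activeGates t zeros   ≡⟨ ℕ.*-suc 2 (activeGates t zeros) ⟨
  2 ℕ.* suc (activeGates t zeros)   ∎
  where open ℕ.≤-Reasoning
nots-zeros (and s t) =
  nots-step (bit (evalTree (and s t) zeros)) {ms = nots s} {nots t}
    {as = activeGates s zeros} {activeGates t zeros} (nots-zeros s) (nots-zeros t)
nots-zeros (or s t) =
  nots-step (bit (evalTree (or s t) zeros)) {ms = nots s} {nots t}
    {as = activeGates s zeros} {activeGates t zeros} (nots-zeros s) (nots-zeros t)

-- The all-ones input: leaves against firing gates and NOT gates.

bit≤1 : ∀ b → bit b ℕ.≤ 1
bit≤1 true  = s≤s z≤n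
bit≤1 false = z≤n

-- A tree without NOT gates is monotone and keeps the value 1 of its leaves, so a subtree with
-- output 0 contains a NOT gate that can be charged.
ones-or-not : (t : Tree n) → 1 ℕ.≤ bit (evalTree t ones) ℕ.+ nots t
ones-or-not (var i) rewrite lookup-replicate i true = s≤s z≤n
ones-or-not (not t) = ℕ.m≤n⇒m≤o+n (bit (Bool.not (evalTree t ones))) (s≤s z≤n)
ones-or-not (and s t) with evalTree s ones | evalTree t ones | ones-or-not s | ones-or-not t
... | true  | true  | _  | _  = s≤s z≤n
... | true  | false | _  | ht = ℕ.m≤n⇒m≤o+n (nots s) ht
... | false | _     | hs | _  = ℕ.m≤n⇒m≤n+o (nots t) hs
ones-or-not (or s t) with evalTree s ones | evalTree t ones | ones-or-not s
... | true  | _     | _  = s≤s z≤n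
... | false | true  | _  = s≤s z≤n
... | false | false | hs = ℕ.m≤n⇒m≤n+o (nots t) hs

-- In the critical case one child is 1 and the other 0: the 1 is lost, and a NOT gate in the subtree
-- with output 0 pays for it.
bits-and : ∀ x y {ms mt} → 1 ℕ.≤ bit x ℕ.+ ms → 1 ℕ.≤ bit y ℕ.+ mt →
           bit x ℕ.+ bit y ℕ.≤ 2 ℕ.* bit (x ∧ y) ℕ.+ (ms ℕ.+ mt)
bits-and true  true  _  _  = s≤s (s≤s z≤n)
bits-and true  false {ms} _ ht = ℕ.m≤n⇒m≤o+n ms ht
bits-and false y {mt = mt} hs _ = ℕ.≤-trans (bit≤1 y) (ℕ.m≤n⇒m≤n+o mt hs)

-- An OR gate with a child at 1 fires, and the 2 covers both children, so no NOT gate has to be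
-- charged.
bits-or : ∀ x y m → bit x ℕ.+ bit y ℕ.≤ 2 ℕ.* bit (x ∨ y) ℕ.+ m
bits-or true  y     m = s≤s (ℕ.≤-trans (bit≤1 y) (s≤s z≤n))
bits-or false true  m = s≤s z≤n
bits-or false false m = z≤n

-- The depth grows by one, so the product gains one unit per NOT gate, which absorbs `ms + mt`; 2 b
-- splits into the gate's value and its firing.
leaves-step : ∀ b {ls lt bs bt as at ms mt ds dt} →
              bs ℕ.+ bt ℕ.≤ 2 ℕ.* b ℕ.+ (ms ℕ.+ mt) →
              ls ℕ.≤ bs ℕ.+ as ℕ.+ ms ℕ.* ds →
              lt ℕ.≤ bt ℕ.+ at ℕ.+ mt ℕ.* dt →
              ls ℕ.+ lt ℕ.≤ b ℕ.+ (b ℕ.+ (as ℕ.+ at)) ℕ.+ (ms ℕ.+ mt) ℕ.* suc (ds ℕ.⊔ dt)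
leaves-step b {ls} {lt} {bs} {bt} {as} {at} {ms} {mt} {ds} {dt} hb hs ht = begin
  ls ℕ.+ lt
    ≤⟨ ℕ.+-mono-≤ hs ht ⟩
  (bs ℕ.+ as ℕ.+ ms ℕ.* ds) ℕ.+ (bt ℕ.+ at ℕ.+ mt ℕ.* dt)
    ≤⟨ ℕ.+-mono-≤ (ℕ.+-monoʳ-≤ (bs ℕ.+ as) (ℕ.*-monoʳ-≤ ms (ℕ.m≤m⊔n ds dt)))
                  (ℕ.+-monoʳ-≤ (bt ℕ.+ at) (ℕ.*-monoʳ-≤ mt (ℕ.m≤n⊔m ds dt))) ⟩
  (bs ℕ.+ as ℕ.+ ms ℕ.* d) ℕ.+ (bt ℕ.+ at ℕ.+ mt ℕ.* d)
    ≡⟨ collect bs bt as at ms mt d ⟩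
  (bs ℕ.+ bt) ℕ.+ (as ℕ.+ at ℕ.+ (ms ℕ.+ mt) ℕ.* d)
    ≤⟨ ℕ.+-monoˡ-≤ _ hb ⟩
  (2 ℕ.* b ℕ.+ (ms ℕ.+ mt)) ℕ.+ (as ℕ.+ at ℕ.+ (ms ℕ.+ mt) ℕ.* d)
    ≡⟨ distribute b as at (ms ℕ.+ mt) d ⟩
  b ℕ.+ (b ℕ.+ (as ℕ.+ at)) ℕ.+ (ms ℕ.+ mt) ℕ.* suc d ∎
  where
  open ℕ.≤-Reasoning
  d = ds ℕ.⊔ dt
  collect : ∀ u v x y p q d → (u ℕ.+ x ℕ.+ p ℕ.* d) ℕ.+ (v ℕ.+ y ℕ.+ q ℕ.* d) ≡
                              (u ℕ.+ v) ℕ.+ (x ℕ.+ y ℕ.+ (p ℕ.+ q) ℕ.* d)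
  collect = solve-∀
  distribute : ∀ b x y m d → (2 ℕ.* b ℕ.+ m) ℕ.+ (x ℕ.+ y ℕ.+ m ℕ.* d) ≡
                             b ℕ.+ (b ℕ.+ (x ℕ.+ y)) ℕ.+ m ℕ.* suc d
  distribute = solve-∀

-- Each leaf starts with one unit, its value 1. A firing binary gate passes one unit up and leaves
-- one in `activeGates`; lost units are charged to NOT gates, each at most once per level.
leaves-ones : (t : Tree n) →
              leavesTree t ℕ.≤ bit (evalTree t ones) ℕ.+ activeGates t ones
                               ℕ.+ nots t ℕ.* depthTree t
leaves-ones (var i) rewrite lookup-replicate i true = s≤s z≤n
leaves-ones (not t) = begin
  leavesTree t
    ≤⟨ leaves-ones t ⟩
  bit (evalTree t ones) ℕ.+ a ℕ.+ m ℕ.* d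
    -- The child's value is charged to this NOT gate: (m + 1)(d + 1) exceeds m d by at least 1.
    ≤⟨ ℕ.+-monoˡ-≤ (m ℕ.* d) (ℕ.+-monoˡ-≤ a (bit≤1 (evalTree t ones))) ⟩
  1 ℕ.+ a ℕ.+ m ℕ.* d
    ≤⟨ ℕ.m≤m+n _ (2 ℕ.* b ℕ.+ m ℕ.+ d) ⟩
  1 ℕ.+ a ℕ.+ m ℕ.* d ℕ.+ (2 ℕ.* b ℕ.+ m ℕ.+ d)
    ≡⟨ expand a b m d ⟩
  b ℕ.+ (b ℕ.+ a) ℕ.+ suc m ℕ.* suc d ∎
  where
  open ℕ.≤-Reasoning
  a = activeGates t ones
  b = bit (Bool.not (evalTree t ones))
  m = nots t
  d = depthTree t
  expand : ∀ a b m d → 1 ℕ.+ a ℕ.+ m ℕ.* d ℕ.+ (2 ℕ.* b ℕ.+ m ℕ.+ d) ≡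
                       b ℕ.+ (b ℕ.+ a) ℕ.+ suc m ℕ.* suc d
  expand = solve-∀
leaves-ones (and s t) =
  leaves-step (bit (evalTree (and s t) ones))
    {bs = bit (evalTree s ones)} {bit (evalTree t ones)}
    {activeGates s ones} {activeGates t ones} {nots s} {nots t}
    (bits-and (evalTree s ones) (evalTree t ones) (ones-or-not s) (ones-or-not t))
    (leaves-ones s) (leaves-ones t)
leaves-ones (or s t) =
  leaves-step (bit (evalTree (or s t) ones))
    {bs = bit (evalTree s ones)} {bit (evalTree t ones)}
    {activeGates s ones} {activeGates t ones} {nots s} {nots t}
    (bits-or (evalTree s ones) (evalTree t ones) (nots s ℕ.+ nots t))
    (leaves-ones s) (leaves-ones t)

-- Combining the two inputs.

activeGates≤ECᶠ : (F : Formula n) (a : Input n) → activeGates (tree F) a ℕ.≤ ECᶠ F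
activeGates≤ECᶠ F a =
  v≤max⁺ 0 _ (inj₂ (lose (∈-map⁺ (activeGates (tree F)) (inputs-complete a)) ℕ.≤-refl))

1≤depth : (F : Formula n) → 1 ℕ.≤ depth F
1≤depth (formula _ not) = s≤s z≤n
1≤depth (formula _ and) = s≤s z≤n
1≤depth (formula _ or)  = s≤s z≤n

L≤[depth+2ECᶠ]² : (F : Formula n) →
  L F ℕ.≤ (depth F ℕ.+ 2 ℕ.* ECᶠ F) ℕ.* (depth F ℕ.+ 2 ℕ.* ECᶠ F)
L≤[depth+2ECᶠ]² F = begin
  L F
    ≤⟨ leaves-ones t ⟩
  bit (evalTree t ones) ℕ.+ activeGates t ones ℕ.+ nots t ℕ.* d
    ≤⟨ ℕ.+-mono-≤ (ℕ.+-mono-≤ (bit≤1 (evalTree t ones)) (activeGates≤ECᶠ F ones))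
                  (ℕ.*-monoˡ-≤ d nots≤2E) ⟩
  1 ℕ.+ E ℕ.+ 2 ℕ.* E ℕ.* d
    -- As d ≥ 1, 1 grows to d² and E to E d, so that all terms are quadratic and the square can be
    -- completed.
    ≤⟨ ℕ.+-monoˡ-≤ (2 ℕ.* E ℕ.* d)
         (ℕ.+-mono-≤ (ℕ.*-mono-≤ (1≤depth F) (1≤depth F)) (ℕ.m≤m*n E d)) ⟩
  d ℕ.* d ℕ.+ E ℕ.* d ℕ.+ 2 ℕ.* E ℕ.* d
    ≤⟨ ℕ.m≤m+n _ (E ℕ.* d ℕ.+ 4 ℕ.* (E ℕ.* E)) ⟩
  d ℕ.* d ℕ.+ E ℕ.* d ℕ.+ 2 ℕ.* E ℕ.* d ℕ.+ (E ℕ.* d ℕ.+ 4 ℕ.* (E ℕ.* E))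
    ≡⟨ square d E ⟩
  (d ℕ.+ 2 ℕ.* E) ℕ.* (d ℕ.+ 2 ℕ.* E) ∎
  where
  open ℕ.≤-Reasoning
  t = tree F
  d = depth F
  E = ECᶠ F
  instance
    d-nonZero : ℕ.NonZero d
    d-nonZero = ℕ.>-nonZero (1≤depth F)
  nots≤2E : nots t ℕ.≤ 2 ℕ.* E
  nots≤2E = ℕ.≤-trans (ℕ.m+n≤o⇒m≤o (nots t) (nots-zeros t))
                      (ℕ.*-monoʳ-≤ 2 (activeGates≤ECᶠ F zeros))
  square : ∀ d E →
    d ℕ.* d ℕ.+ E ℕ.* d ℕ.+ 2 ℕ.* E ℕ.* d ℕ.+ (E ℕ.* d ℕ.+ 4 ℕ.* (E ℕ.* E)) ≡
    (d ℕ.+ 2 ℕ.* E) ℕ.* (d ℕ.+ 2 ℕ.* E)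
  square = solve-∀

-- Passage to the rationals and the cut of the square root.

-- For a variable `m` the gcd inside `_/_` blocks reduction; the explicit fraction lets sums,
-- products and comparisons compute.
fromℕ-normal : ∀ m → fromℕ m ≡ mkℚ (+ m) 0 (Coprime.sym (Coprime.1-coprimeTo m))
fromℕ-normal m = ℚ.normalize-coprime (Coprime.sym (Coprime.1-coprimeTo m))

fromℕ-homo-+ : ∀ m k → fromℕ (m ℕ.+ k) ≡ fromℕ m + fromℕ k
fromℕ-homo-+ m k rewrite fromℕ-normal m | fromℕ-normal k =
  cong (_/ 1) (cong₂ ℤ._+_ (sym (ℤ.*-identityʳ (+ m))) (sym (ℤ.*-identityʳ (+ k))))

fromℕ-homo-* : ∀ m k → fromℕ (m ℕ.* k) ≡ fromℕ m * fromℕ k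
fromℕ-homo-* m k rewrite fromℕ-normal m | fromℕ-normal k = cong (_/ 1) (ℤ.pos-* m k)

fromℕ-mono-≤ : ∀ {m k} → m ℕ.≤ k → fromℕ m ≤ fromℕ k
fromℕ-mono-≤ {m} {k} m≤k rewrite fromℕ-normal m | fromℕ-normal k =
  *≤* (ℤ.*-monoʳ-≤-nonNeg (+ 1) (ℤ.+≤+ m≤k))

-- `p` may be negative: in the case to refute, q < p already makes it positive.
square-cancel-≤ : ∀ {p q} → 0ℚ ≤ q → p * p ≤ q * q → p ≤ q
square-cancel-≤ {p} {q} 0≤q pp≤qq with p ℚ.≤? q
... | yes p≤q = p≤q
... | no  p≰q = contradiction (ℚ.<-≤-trans qq<pp pp≤qq) (ℚ.<-irrefl refl)
  where
  open ℚ.≤-Reasoning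
  q<p : q < p
  q<p = ℚ.≰⇒> p≰q
  qq<pp : q * q < p * p
  qq<pp = begin-strict
    q * q ≤⟨ ℚ.*-monoˡ-≤-nonNeg q {{nonNegative 0≤q}} (ℚ.<⇒≤ q<p) ⟩
    q * p <⟨ ℚ.*-monoˡ-<-pos p {{positive (ℚ.≤-<-trans 0≤q q<p)}} q<p ⟩
    p * p ∎

≤√-bound : ∀ {r m} k → r ≤√ m → m ℕ.≤ k ℕ.* k → r ≤ fromℕ k
≤√-bound k (inj₁ r≤0) _ = ℚ.≤-trans r≤0 (fromℕ-mono-≤ {0} {k} z≤n)
≤√-bound {r} k (inj₂ rr≤m) m≤kk =
  square-cancel-≤ (fromℕ-mono-≤ {0} {k} z≤n)
    (subst (r * r ≤_) (fromℕ-homo-* k k) (ℚ.≤-trans rr≤m (fromℕ-mono-≤ m≤kk)))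

½[r-d]≤e : ∀ {r} d e → r ≤ fromℕ (d ℕ.+ 2 ℕ.* e) → ½ * (r - fromℕ d) ≤ fromℕ e
½[r-d]≤e {r} d e r≤d+2e = begin
  ½ * (r - fromℕ d)
    ≤⟨ ℚ.*-monoˡ-≤-nonNeg ½ (ℚ.+-monoˡ-≤ (- fromℕ d) r≤d+2e) ⟩
  ½ * (fromℕ (d ℕ.+ 2 ℕ.* e) - fromℕ d)
    ≡⟨ cong (λ x → ½ * (x - fromℕ d)) (fromℕ-homo-+ d (2 ℕ.* e)) ⟩
  ½ * (fromℕ d + fromℕ (2 ℕ.* e) - fromℕ d)
    ≡⟨ cong (½ *_) (xyx⁻¹≈y ℚ.+-0-abelianGroup (fromℕ d) (fromℕ (2 ℕ.* e))) ⟩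
  ½ * fromℕ (2 ℕ.* e)
    ≡⟨ cong (½ *_) (fromℕ-homo-* 2 e) ⟩
  ½ * (fromℕ 2 * fromℕ e)
    ≡⟨ ℚ.*-assoc ½ (fromℕ 2) (fromℕ e) ⟨
  ½ * fromℕ 2 * fromℕ e
    -- `½ * fromℕ 2` evaluates to 1.
    ≡⟨ ℚ.*-identityˡ (fromℕ e) ⟩
  fromℕ e ∎
  where open ℚ.≤-Reasoning

theorem1p5 : ∃[ c ] 0ℚ < c ×
    (∀ (n : ℕ) (f : Input n → Bool) (F : Formula n) → F Computes f →
    ∀ (r : ℚ) → r ≤√ L F → c * (r - fromℕ (depth F)) ≤ fromℕ (ECᶠ F))
-- The constant ½ is the inverse of the factor 2 in √L ≤ d + 2 E.
theorem1p5 = ½ , *<* (ℤ.+<+ (s≤s z≤n)) , λ n f F _ r r≤√L →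
  ½[r-d]≤e (depth F) (ECᶠ F)
    (≤√-bound (depth F ℕ.+ 2 ℕ.* ECᶠ F) r≤√L (L≤[depth+2ECᶠ]² F))
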